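{- The independence polynomial $Ind(G;x)$ and the clique polynomial $Cl(G;x)$ are both weakly distinguishing; i.e. almost all graphs $G$ have an $Ind$-mate and almost all graphs $G$ have a $Cl$-mate.
   Context: All graphs are finite and simple. For a graph $G$ and $i\ge 1$, let $c_i(G)$ be the number of vertex subsets $A\subseteq V(G)$ with $G[A]$ isomorphic to the complete graph $K_i$, and $s_i(G)$ the number of $A\subseteq V(G)$ with $G[A]$ edgeless on $i$ vertices. Then $Cl(G;x)=1+\sum_{i\ge1} c_i(G)x^i$ and $Ind(G;x)=1+\sum_{i\ge 1}s_i(G)x^i$. For a graph polynomial $P$ (an isomorphism-invariant map from graphs to polynomials), $H$ is a $P$-mate of $G$ if $P(G)=P(H)$ and $H\not\cong G$; $G$ is $P$-unique if it has no $P$-mate. Let $\mathcal{G}(n)$ be the set of isomorphism classes of graphs on $n$ vertices and $U_P(n)$ the set of $P$-unique graphs in $\mathcal{G}(n)$. $P$ is weakly distinguishing if $\lim_{n\to\infty}|U_P(n)|/|\mathcal{G}(n)|=0$. -}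

module Defs where

open import Data.Bool using (Bool; false; not)
import Data.Bool.Properties as Bool
open import Data.Fin using (Fin; zero; suc)
import Data.Fin.Properties as Fin
open import Data.Fin.Permutation using (↔⇒≡)
open import Data.Fin.Subset using (Subset; inside; outside; _∈_; ∣_∣)
open import Data.Fin.Subset.Properties using (_∈?_; ∣p∣≤n)
open import Data.Integer using (ℤ; +_; 0ℤ; 1ℤ)
open import Data.List using (List; []; _∷_; _++_; map; filter; length)
open import Data.List.Membership.Propositional using () renaming (_∈_ to _∈ᴸ_)
open import Data.List.Membership.Propositional.Properties using (∈-map⁺; ∈-map⁻; ∈-++⁺ˡ; ∈-++⁺ʳ; ∈-filter⁺; ∈-filter⁻)
open import Data.List.Membership.Propositional.Properties.WithK using (unique∧set⇒bag)
open import Data.List.Properties using (length-map; filter-none)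
open import Data.List.Relation.Binary.BagAndSetEquality using (∼bag⇒↭)
open import Data.List.Relation.Binary.Permutation.Propositional.Properties using (↭-length)
import Data.List.Relation.Unary.All as All
open import Data.List.Relation.Unary.Any using (here)
import Data.List.Relation.Unary.AllPairs as AllPairs
open import Data.List.Relation.Unary.Unique.Propositional using (Unique)
import Data.List.Relation.Unary.Unique.Propositional.Properties as Unique
open import Data.Nat using (ℕ; zero; suc; _<_; _≥_; NonZero)
import Data.Nat.Properties as ℕ
open import Data.Product using (∃; ∃-syntax; Σ-syntax; _×_; _,_; proj₁; proj₂)
open import Data.Rational.Unnormalised using (ℚᵘ; 0ℚᵘ; 1ℚᵘ; _/_; _-_) renaming (∣_∣ to ∣_∣ℚ; _<_ to _<ℚ_)
open import Data.Vec using ([]; _∷_; here; there; lookup; tabulate)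
open import Data.Vec.Properties using ([]=⇒lookup; lookup⇒[]=; lookup∘tabulate; tabulate∘lookup; tabulate-cong; ∷-injectiveʳ)
open import Data.Vec.Properties.WithK using ([]=-irrelevant)
open import Function using (_∘_; _↔_; mk↔ₛ′; mk⇔; Inverse; Bijection)
open import Function.Construct.Identity using (↔-id)
open import Function.Construct.Symmetry using (↔-sym)
open import Function.Construct.Composition using (_↔-∘_)
open import Level using (0ℓ)
open import Relation.Binary.Bundles using (Setoid)
import Relation.Binary.Construct.On as On
open import Relation.Binary.PropositionalEquality using (_≡_; _≢_; refl; sym; trans; cong; subst)
import Relation.Binary.PropositionalEquality as ≡
open import Relation.Nullary using (¬_; Dec; yes; no; does)
open import Relation.Nullary.Decidable using (map′; _×-dec_; _→-dec_; dec-true; dec-false)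
open import Relation.Unary using (Decidable)

private
  variable
    V W X : Set
    m n : ℕ

record Graph (V : Set) : Set where
  field
    adj     : V → V → Bool
    adj-sym : ∀ u v → adj u v ≡ adj v u
    irrefl  : ∀ v → adj v v ≡ false

open Graph public

infix 4 _≅_

record _≅_ (G : Graph V) (H : Graph W) : Set where
  field
    bijection : V ↔ W
  open Inverse bijection public using (to; from; strictlyInverseˡ; strictlyInverseʳ)
  field
    preserves : ∀ u v → adj G u v ≡ adj H (to u) (to v)

≅-refl : {G : Graph V} → G ≅ G
≅-refl = record { bijection = ↔-id _ ; preserves = λ _ _ → refl }

≅-sym : {G : Graph V} {H : Graph W} → G ≅ H → H ≅ G
≅-sym {H = H} e = record
  { bijection = ↔-sym bijection
  ; preserves = λ u v → sym (trans (preserves (from u) (from v))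
      (≡.cong₂ (adj H) (strictlyInverseˡ u) (strictlyInverseˡ v)))
  } where open _≅_ e

≅-trans : {G : Graph V} {H : Graph W} {K : Graph X} → G ≅ H → H ≅ K → G ≅ K
≅-trans e f = record
  { bijection = _≅_.bijection f ↔-∘ _≅_.bijection e
  ; preserves = λ u v → trans (_≅_.preserves e u v) (_≅_.preserves f _ _)
  }

-- The quotient 𝒢(n) of graphs on n vertices by isomorphism, as a setoid.
𝒢 : ℕ → Setoid 0ℓ 0ℓ
𝒢 n = record
  { Carrier = Graph (Fin n)
  ; _≈_ = _≅_
  ; isEquivalence = record { refl = ≅-refl ; sym = ≅-sym ; trans = ≅-trans }
  }

complete : ∀ i → Graph (Fin i)
complete i = record
  { adj     = λ u v → not (does (u Fin.≟ v))
  ; adj-sym = symm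
  ; irrefl  = λ v → cong not (dec-true (v Fin.≟ v) refl)
  }
  where
  symm : ∀ u v → not (does (u Fin.≟ v)) ≡ not (does (v Fin.≟ u))
  symm u v with u Fin.≟ v
  ... | yes u≡v = cong not (sym (dec-true (v Fin.≟ u) (sym u≡v)))
  ... | no  u≢v = cong not (sym (dec-false (v Fin.≟ u) (u≢v ∘ sym)))

Edgeless : Graph V → Set
Edgeless G = ∀ u v → adj G u v ≡ false

infix 20 _[_]

_[_] : Graph (Fin n) → (A : Subset n) → Graph (∃[ v ] v ∈ A)
G [ A ] = record
  { adj     = λ u v → adj G (proj₁ u) (proj₁ v)
  ; adj-sym = λ u v → adj-sym G (proj₁ u) (proj₁ v)
  ; irrefl  = λ v → irrefl G (proj₁ v)
  }

∈-≡ : {A : Subset n} {x y : ∃[ v ] v ∈ A} → proj₁ x ≡ proj₁ y → x ≡ y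
∈-≡ {x = v , p} {y = .v , q} refl = cong (v ,_) ([]=-irrelevant p q)

elements↔ : (A : Subset n) → Fin ∣ A ∣ ↔ (∃[ v ] v ∈ A)
elements↔ [] = mk↔ₛ′ (λ ()) (λ ()) (λ ()) (λ ())
elements↔ (outside ∷ A) = mk↔ₛ′ f g fg gf
  where
  open Inverse (elements↔ A)
  f : Fin ∣ A ∣ → ∃[ v ] v ∈ outside ∷ A
  f i = suc (proj₁ (to i)) , there (proj₂ (to i))
  g : (∃[ v ] v ∈ outside ∷ A) → Fin ∣ A ∣
  g (suc v , there p) = from (v , p)
  fg : ∀ x → f (g x) ≡ x
  fg (suc v , there p) = ∈-≡ (cong (suc ∘ proj₁) (strictlyInverseˡ (v , p)))
  gf : ∀ i → g (f i) ≡ i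
  gf = strictlyInverseʳ
elements↔ (inside ∷ A) = mk↔ₛ′ f g fg gf
  where
  open Inverse (elements↔ A)
  f : Fin (suc ∣ A ∣) → ∃[ v ] v ∈ inside ∷ A
  f zero    = zero , here
  f (suc i) = suc (proj₁ (to i)) , there (proj₂ (to i))
  g : (∃[ v ] v ∈ inside ∷ A) → Fin (suc ∣ A ∣)
  g (zero  , here)    = zero
  g (suc v , there p) = suc (from (v , p))
  fg : ∀ x → f (g x) ≡ x
  fg (zero  , here)    = refl
  fg (suc v , there p) = ∈-≡ (cong (suc ∘ proj₁) (strictlyInverseˡ (v , p)))
  gf : ∀ i → g (f i) ≡ i
  gf zero    = refl
  gf (suc i) = cong suc (strictlyInverseʳ i)

all∈? : (A : Subset n) {P : Fin n → Fin n → Set} → (∀ u v → Dec (P u v)) →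
        Dec (∀ (u v : ∃[ w ] w ∈ A) → P (proj₁ u) (proj₁ v))
all∈? A P? = map′
  (λ f u v → f (proj₁ u) (proj₁ v) (proj₂ u) (proj₂ v))
  (λ f u v u∈ v∈ → f (u , u∈) (v , v∈))
  (Fin.all? λ u → Fin.all? λ v → (u ∈? A) →-dec ((v ∈? A) →-dec P? u v))

∣∣≡ : (G : Graph (Fin n)) (A : Subset n) → ∀ {i} → G [ A ] ≅ complete i → ∣ A ∣ ≡ i
∣∣≡ G A e = ↔⇒≡ (_≅_.bijection e ↔-∘ elements↔ A)

edgeless? : (G : Graph (Fin n)) (A : Subset n) → Dec (Edgeless (G [ A ]))
edgeless? G A = all∈? A (λ u v → adj G u v Bool.≟ false)

≅complete? : (G : Graph (Fin n)) (A : Subset n) → ∀ i → Dec (G [ A ] ≅ complete i)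
≅complete? G A i = map′ fwd bwd
  ((∣ A ∣ ℕ.≟ i) ×-dec all∈? A (λ u v → adj G u v Bool.≟ not (does (u Fin.≟ v))))
  where
  Complete = ∀ (u v : ∃[ w ] w ∈ A) →
    adj G (proj₁ u) (proj₁ v) ≡ not (does (proj₁ u Fin.≟ proj₁ v))

  fwd : ∣ A ∣ ≡ i × Complete → G [ A ] ≅ complete i
  fwd (refl , c) = record
    { bijection = ↔-sym (elements↔ A)
    ; preserves = λ u v → trans (c u v) (cong not (same u v))
    }
    where
    open Inverse (elements↔ A)
    same : ∀ u v → does (proj₁ u Fin.≟ proj₁ v) ≡ does (from u Fin.≟ from v)
    same u v with proj₁ u Fin.≟ proj₁ v
    ... | yes eq = sym (dec-true (from u Fin.≟ from v) (cong from (∈-≡ eq)))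
    ... | no neq = sym (dec-false (from u Fin.≟ from v) λ eq → neq (cong proj₁
            (trans (sym (strictlyInverseˡ u)) (trans (cong to eq) (strictlyInverseˡ v)))))

  bwd : G [ A ] ≅ complete i → ∣ A ∣ ≡ i × Complete
  bwd e = ∣∣≡ G A e , λ u v → trans (preserves u v) (cong not (same u v))
    where
    open _≅_ e
    same : ∀ u v → does (to u Fin.≟ to v) ≡ does (proj₁ u Fin.≟ proj₁ v)
    same u v with proj₁ u Fin.≟ proj₁ v
    ... | yes eq = dec-true (to u Fin.≟ to v) (cong to (∈-≡ eq))
    ... | no neq = dec-false (to u Fin.≟ to v) λ eq → neq (cong proj₁
            (trans (sym (strictlyInverseʳ u)) (trans (cong from eq) (strictlyInverseʳ v))))

subsets : ∀ n → List (Subset n)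
subsets zero    = [] ∷ []
subsets (suc n) = map (outside ∷_) (subsets n) ++ map (inside ∷_) (subsets n)

#subsets : {P : Subset n → Set} → Decidable P → ℕ
#subsets {n} P? = length (filter P? (subsets n))

c : ℕ → Graph (Fin n) → ℕ
c i G = #subsets (λ A → ≅complete? G A i)

s : ℕ → Graph (Fin n) → ℕ
s i G = #subsets (λ A → (∣ A ∣ ℕ.≟ i) ×-dec edgeless? G A)

∈-subsets : (A : Subset n) → A ∈ᴸ subsets n
∈-subsets []            = here refl
∈-subsets (outside ∷ A) = ∈-++⁺ˡ (∈-map⁺ (outside ∷_) (∈-subsets A))
∈-subsets (inside ∷ A)  = ∈-++⁺ʳ (map (outside ∷_) (subsets _)) (∈-map⁺ (inside ∷_) (∈-subsets A))

subsets-unique : ∀ n → Unique (subsets n)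
subsets-unique zero    = All.[] AllPairs.∷ AllPairs.[]
subsets-unique (suc n) = Unique.++⁺
  (Unique.map⁺ ∷-injectiveʳ (subsets-unique n))
  (Unique.map⁺ ∷-injectiveʳ (subsets-unique n))
  disjoint
  where
  disjoint : ∀ {A} → ¬ (A ∈ᴸ map (outside ∷_) (subsets n) × A ∈ᴸ map (inside ∷_) (subsets n))
  disjoint (p , q) with ∈-map⁻ (outside ∷_) p | ∈-map⁻ (inside ∷_) q
  ... | _ , _ , refl | _ , _ , ()

image : Fin m ↔ Fin n → Subset m → Subset n
image π A = tabulate (lookup A ∘ Inverse.from π)

image-sym : (π : Fin m ↔ Fin n) (A : Subset m) → image (↔-sym π) (image π A) ≡ A
image-sym π A = trans
  (tabulate-cong λ v → trans (lookup∘tabulate _ (to v)) (cong (lookup A) (strictlyInverseʳ v)))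
  (tabulate∘lookup A)
  where open Inverse π

#subsets-cong : (π : Fin m ↔ Fin n)
  {P : Subset m → Set} (P? : Decidable P) {Q : Subset n → Set} (Q? : Decidable Q) →
  (∀ A → P A → Q (image π A)) → (∀ B → Q B → P (image (↔-sym π) B)) →
  #subsets P? ≡ #subsets Q?
#subsets-cong {m} {n} π P? Q? P⇒Q Q⇒P = trans
  (sym (length-map (image π) (filter P? (subsets m))))
  (↭-length (∼bag⇒↭ (unique∧set⇒bag
    (Unique.map⁺ injective (Unique.filter⁺ P? (subsets-unique m)))
    (Unique.filter⁺ Q? (subsets-unique n))
    (mk⇔ fwd bwd))))
  where
  injective : ∀ {A B} → image π A ≡ image π B → A ≡ B
  injective {A} {B} eq =
    trans (sym (image-sym π A)) (trans (cong (image (↔-sym π)) eq) (image-sym π B))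
  fwd : ∀ {B} → B ∈ᴸ map (image π) (filter P? (subsets m)) → B ∈ᴸ filter Q? (subsets n)
  fwd p with ∈-map⁻ (image π) p
  ... | A , A∈ , refl = ∈-filter⁺ Q? (∈-subsets _)
          (P⇒Q A (proj₂ (∈-filter⁻ P? {xs = subsets m} A∈)))
  bwd : ∀ {B} → B ∈ᴸ filter Q? (subsets n) → B ∈ᴸ map (image π) (filter P? (subsets m))
  bwd {B} p = subst (_∈ᴸ map (image π) (filter P? (subsets m))) (image-sym (↔-sym π) B)
    (∈-map⁺ (image π) (∈-filter⁺ P? (∈-subsets _)
      (Q⇒P B (proj₂ (∈-filter⁻ Q? {xs = subsets n} p)))))

[]-cong : {G : Graph (Fin m)} {H : Graph (Fin n)} (e : G ≅ H) (A : Subset m) →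
          G [ A ] ≅ H [ image (_≅_.bijection e) A ]
[]-cong {m} {n} {G} {H} e A = record
  { bijection = mk↔ₛ′ f g
      (λ y → ∈-≡ (strictlyInverseˡ (proj₁ y)))
      (λ x → ∈-≡ (strictlyInverseʳ (proj₁ x)))
  ; preserves = λ u v → preserves (proj₁ u) (proj₁ v)
  }
  where
  open _≅_ e
  f : (∃[ v ] v ∈ A) → ∃[ w ] w ∈ image bijection A
  f (v , p) = to v , lookup⇒[]= _ _ (trans (lookup∘tabulate _ (to v))
    (trans (cong (lookup A) (strictlyInverseʳ v)) ([]=⇒lookup p)))
  g : (∃[ w ] w ∈ image bijection A) → ∃[ v ] v ∈ A
  g (w , p) = from w , lookup⇒[]= _ _ (trans (sym (lookup∘tabulate _ w)) ([]=⇒lookup p))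

edgeless-cong : {G : Graph V} {H : Graph W} → G ≅ H → Edgeless G → Edgeless H
edgeless-cong e E u v = trans (_≅_.preserves (≅-sym e) u v) (E _ _)

∣∣-cong : {G : Graph (Fin m)} {H : Graph (Fin n)} {A : Subset m} {B : Subset n} →
          G [ A ] ≅ H [ B ] → ∣ A ∣ ≡ ∣ B ∣
∣∣-cong {A = A} {B} e = ↔⇒≡ (↔-sym (elements↔ B) ↔-∘ (_≅_.bijection e ↔-∘ elements↔ A))

c-cong : {G : Graph (Fin m)} {H : Graph (Fin n)} → G ≅ H → ∀ i → c i G ≡ c i H
c-cong {G = G} {H} e i = #subsets-cong (_≅_.bijection e)
  (λ A → ≅complete? G A i) (λ A → ≅complete? H A i)
  (λ A → ≅-trans (≅-sym ([]-cong e A)))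
  (λ B → ≅-trans (≅-sym ([]-cong (≅-sym e) B)))

s-cong : {G : Graph (Fin m)} {H : Graph (Fin n)} → G ≅ H → ∀ i → s i G ≡ s i H
s-cong {G = G} {H} e i = #subsets-cong (_≅_.bijection e)
  (λ A → (∣ A ∣ ℕ.≟ i) ×-dec edgeless? G A) (λ A → (∣ A ∣ ℕ.≟ i) ×-dec edgeless? H A)
  (λ A → transport e A)
  (λ B → transport (≅-sym e) B)
  where
  transport : ∀ {m n} {G : Graph (Fin m)} {H : Graph (Fin n)} (e : G ≅ H) A →
              ∣ A ∣ ≡ i × Edgeless (G [ A ]) →
              let B = image (_≅_.bijection e) A in ∣ B ∣ ≡ i × Edgeless (H [ B ])
  transport {G = G} {H} e A (∣A∣≡i , E) =
    trans (sym (∣∣-cong {G = G} {H} ([]-cong e A))) ∣A∣≡i ,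
    edgeless-cong ([]-cong e A) E

#subsets-none : {P : Subset n → Set} (P? : Decidable P) → (∀ A → ¬ P A) → #subsets P? ≡ 0
#subsets-none {n} P? ¬P = cong length (filter-none P? (All.universal ¬P (subsets n)))

∣∣≢ : {A : Subset n} {i : ℕ} → n < i → ∣ A ∣ ≢ i
∣∣≢ {A = A} n<i refl = ℕ.<⇒≱ n<i (∣p∣≤n A)

-- ℤ[x], as finitely supported sequences of coefficients.
record Polynomial : Set where
  field
    coeff  : ℕ → ℤ
    finite : ∃[ d ] (∀ i → d < i → coeff i ≡ 0ℤ)

open Polynomial public

infix 4 _≋_

_≋_ : Polynomial → Polynomial → Set
p ≋ q = ∀ i → coeff p i ≡ coeff q i

record GraphPolynomial : Set where
  field
    poly      : ∀ {n} → Graph (Fin n) → Polynomial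
    invariant : ∀ {m n} {G : Graph (Fin m)} {H : Graph (Fin n)} → G ≅ H → poly G ≋ poly H

open GraphPolynomial public

Cl : GraphPolynomial
Cl = record { poly = clPoly ; invariant = inv }
  where
  clCoeff : Graph (Fin n) → ℕ → ℤ
  clCoeff G zero      = 1ℤ
  clCoeff G i@(suc _) = + c i G
  clPoly : Graph (Fin n) → Polynomial
  clPoly {n} G = record { coeff = clCoeff G ; finite = n , vanish }
    where
    vanish : ∀ i → n < i → clCoeff G i ≡ 0ℤ
    vanish i@(suc _) n<i = cong +_ (#subsets-none (λ A → ≅complete? G A i)
      λ A e → ∣∣≢ {A = A} n<i (∣∣≡ G A e))
  inv : {G : Graph (Fin m)} {H : Graph (Fin n)} → G ≅ H → clPoly G ≋ clPoly H
  inv e zero      = refl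
  inv e i@(suc _) = cong +_ (c-cong e i)

Ind : GraphPolynomial
Ind = record { poly = indPoly ; invariant = inv }
  where
  indCoeff : Graph (Fin n) → ℕ → ℤ
  indCoeff G zero      = 1ℤ
  indCoeff G i@(suc _) = + s i G
  indPoly : Graph (Fin n) → Polynomial
  indPoly {n} G = record { coeff = indCoeff G ; finite = n , vanish }
    where
    vanish : ∀ i → n < i → indCoeff G i ≡ 0ℤ
    vanish i@(suc _) n<i = cong +_ (#subsets-none (λ A → (∣ A ∣ ℕ.≟ i) ×-dec edgeless? G A)
      λ A e → ∣∣≢ {A = A} n<i (proj₁ e))
  inv : {G : Graph (Fin m)} {H : Graph (Fin n)} → G ≅ H → indPoly G ≋ indPoly H
  inv e zero      = refl
  inv e i@(suc _) = cong +_ (s-cong e i)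

IsMate : GraphPolynomial → Graph (Fin m) → Graph (Fin n) → Set
IsMate P H G = poly P G ≋ poly P H × ¬ (H ≅ G)

HasMate : GraphPolynomial → Graph (Fin n) → Set
HasMate P G = ∃[ m ] Σ[ H ∈ Graph (Fin m) ] IsMate P H G

IsUnique : GraphPolynomial → Graph (Fin n) → Set
IsUnique P G = ¬ HasMate P G

-- The setoid equality makes this the number of equivalence classes.
HasCardinality : Setoid 0ℓ 0ℓ → ℕ → Set
HasCardinality S k = Bijection (≡.setoid (Fin k)) S

-- Isomorphism classes of the graphs on n vertices that satisfy Q.
𝒢[_] : (∀ {n} → Graph (Fin n) → Set) → ℕ → Setoid 0ℓ 0ℓ
𝒢[ Q ] n = On.setoid {B = Σ[ G ∈ Graph (Fin n) ] Q G} (𝒢 n) proj₁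

U : GraphPolynomial → ℕ → Setoid 0ℓ 0ℓ
U P = 𝒢[ IsUnique P ]

𝒢-nonZero : ∀ {k} → HasCardinality (𝒢 n) k → NonZero k
𝒢-nonZero {n} {zero}  b with () ← proj₁ (Bijection.surjective b (complete n))
𝒢-nonZero {n} {suc k} b = _

infix 4 _⟶_

_⟶_ : (ℕ → ℚᵘ) → ℚᵘ → Set
a ⟶ ℓ = ∀ ε → 0ℚᵘ <ℚ ε → ∃[ N ] (∀ n → n ≥ N → ∣ a n - ℓ ∣ℚ <ℚ ε)

-- |S n| / |𝒢(n)| tends to ℓ.  Since finiteness of the sets involved is not
-- automatic constructively, the cardinalities are part of the data; they are
-- uniquely determined by S.
record HasDensity (S : ℕ → Setoid 0ℓ 0ℓ) (ℓ : ℚᵘ) : Set where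
  field
    ∣S∣ ∣𝒢∣ : ℕ → ℕ
    ∣S∣-card : ∀ n → HasCardinality (S n) (∣S∣ n)
    ∣𝒢∣-card : ∀ n → HasCardinality (𝒢 n) (∣𝒢∣ n)
  ratio : ℕ → ℚᵘ
  ratio n = _/_ (+ ∣S∣ n) (∣𝒢∣ n) {{𝒢-nonZero (∣𝒢∣-card n)}}
  field
    limit : ratio ⟶ ℓ

WeaklyDistinguishing : GraphPolynomial → Set
WeaklyDistinguishing P = HasDensity (U P) 0ℚᵘ

AlmostAll : (∀ {n} → Graph (Fin n) → Set) → Set
AlmostAll Q = HasDensity 𝒢[ Q ] 1ℚᵘ

{-# OPTIONS --safe #-}

-- The independence polynomial takes few values compared with the number
-- |𝒢(n)| ≥ 2^(n(n-1)/2) / n^n of graphs.  Fix k ≈ n/4.  The polynomials of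
-- degree < k number at most 2^((n+1)k), which bounds the Ind-unique graphs
-- without an independent set of size k.  A graph with an independent set A of
-- size ≥ k is determined by A and its adjacencies on the pairs not inside A, so
-- there are at most 2^n 2^(n(n-1)/2 - k(k-1)/2) of those.  Both bounds are
-- o(|𝒢(n)|).  Complementation carries Ind to Cl.
module Submission where

open import Data.Bool using (Bool; true; false; not; _∧_)
import Data.Bool.Properties as Bool
open import Data.Fin using (Fin; zero; suc; toℕ; fromℕ<; inject≤; combine; join; splitAt; funToFin; finToFun)
import Data.Fin.Properties as Fin
open import Data.Fin.Subset using (Subset; inside; outside; _∈_; ∣_∣; ∁)
open import Data.Fin.Subset.Properties using (_∈?_; x∉p⇒x∈∁p; ∣∁p∣≡n∸∣p∣; ∣p∣≤n)
open import Data.Integer using (+_; +<+)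
import Data.Integer as ℤ using (_+_; _*_; -_; _<_; ∣_∣; _-_; _⊖_)
import Data.Integer.Properties as ℤ
open import Data.List using (List; []; _∷_; map; filter; length; lookup; deduplicate)
open import Data.List.Membership.Propositional using (lose; find)
open import Data.List.Membership.Propositional.Properties using (∈-map⁺; ∈-lookup)
open import Data.List.Properties using (length-map; length-++; length-filter; filter-++; filter-≐)
import Data.List.Relation.Unary.All as All
open import Data.List.Relation.Unary.AllPairs using (_∷_)
open import Data.List.Relation.Unary.Any as Any using (Any; here; there; any?; index)
open import Data.List.Relation.Unary.Any.Properties using (lookup-index)
import Data.List.Relation.Unary.Enumerates.Setoid as Enumerates
open import Data.List.Relation.Unary.Enumerates.Setoid.Properties using (deduplicate⁺; lookup-surjective)
import Data.List.Relation.Unary.Unique.Setoid as UniqueSetoid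
open import Data.List.Relation.Unary.Unique.DecSetoid.Properties using (deduplicate-!)
open import Data.Nat using (ℕ; zero; suc; _+_; _*_; _∸_; _^_; _≤_; _<_; _≥_; _⊔_; z≤n; s≤s; _≤?_; NonZero)
import Data.Nat.DivMod as ℕ
import Data.Nat.Properties as ℕ
open import Data.Nat.Tactic.RingSolver using (solve-∀)
open import Data.Product using (∃; ∃-syntax; _×_; _,_; proj₁; proj₂)
open import Data.Rational.Unnormalised using (mkℚᵘ; 0ℚᵘ; 1ℚᵘ; _/_; _-_; ↧ₙ_; *<*) renaming (∣_∣ to ∣_∣ℚ; _<_ to _<ℚ_)
open import Data.Sum using (_⊎_; inj₁; inj₂)
open import Data.Sum.Properties using (inj₁-injective; inj₂-injective)
open import Data.Vec using (Vec; tabulate; take; drop; here; there) renaming ([] to []ᵛ; _∷_ to _∷ᵛ_; _++_ to _++ᵛ_; lookup to lookupᵛ)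
open import Data.Vec.Properties using (++-injective; take++drop≡id; lookup∘tabulate; tabulate∘lookup; tabulate-cong)
open import Function using (_∘_; mk↔ₛ′; Inverse; Bijection)
open import Function.Construct.Identity using (↔-id)
open import Level using (0ℓ)
open import Relation.Binary.Bundles using (Setoid; DecSetoid)
import Relation.Binary.Construct.On as On
open import Relation.Binary.PropositionalEquality using (_≡_; refl; sym; trans; cong; cong₂; subst; subst₂; setoid; module ≡-Reasoning)
open import Relation.Binary.PropositionalEquality.Properties using (subst-injective)
open import Relation.Nullary using (¬_; Dec; yes; no; does; proof; Reflects; invert; contradiction)
open import Relation.Nullary.Decidable using (map′; _×-dec_; ¬?; decidable-stable; dec-true; dec-false)
open import Relation.Unary using (Decidable)
open import Defs

private
  variable
    A : Set
    m n : ℕ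

-- Cardinalities from enumerations.

lookup-injective : (S : Setoid 0ℓ 0ℓ) {xs : List (Setoid.Carrier S)} → UniqueSetoid.Unique S xs →
                   ∀ {i j} → Setoid._≈_ S (lookup xs i) (lookup xs j) → i ≡ j
lookup-injective S {_ ∷ _} (_ ∷ _)   {zero}  {zero}  _  = refl
lookup-injective S {_ ∷ xs} (x∉ ∷ _) {zero}  {suc j} eq =
  contradiction eq (All.lookup x∉ (∈-lookup {xs = xs} j))
lookup-injective S {_ ∷ xs} (x∉ ∷ _) {suc i} {zero}  eq =
  contradiction (Setoid.sym S eq) (All.lookup x∉ (∈-lookup {xs = xs} i))
lookup-injective S {_ ∷ _} (_ ∷ xs!) {suc i} {suc j} eq = cong suc (lookup-injective S xs! eq)

enumeration⇒card : (S : DecSetoid 0ℓ 0ℓ) → ∀ {xs} → Enumerates.IsEnumeration (DecSetoid.setoid S) xs →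
                   HasCardinality (DecSetoid.setoid S) (length (deduplicate (DecSetoid._≟_ S) xs))
enumeration⇒card S {xs} enum = record
  { to        = lookup (deduplicate _≟_ xs)
  ; cong      = λ { refl → S.refl }
  ; bijective = lookup-injective S.setoid (deduplicate-! S xs)
              , lookup-surjective S.setoid (deduplicate⁺ S enum)
  }
  where
  module S = DecSetoid S
  open S using (_≟_)

module _ {Q : A → Set} (Q? : Decidable Q) where

  restrict : List A → List (∃ Q)
  restrict [] = []
  restrict (x ∷ xs) with Q? x
  ... | yes q = (x , q) ∷ restrict xs
  ... | no  _ = restrict xs

  -- `R` is a predicate rather than equality with one element, since a graph is found in an
  -- enumeration only up to isomorphism.
  restrict⁺ : {R : A → Set} → (∀ {x} → R x → Q x) →
              ∀ {xs} → Any R xs → Any (R ∘ proj₁) (restrict xs)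
  restrict⁺ R⇒Q {x ∷ xs} p with Q? x | p
  ... | yes _ | here r  = here r
  ... | yes _ | there p = there (restrict⁺ R⇒Q p)
  ... | no ¬q | here r  = contradiction (R⇒Q r) ¬q
  ... | no _  | there p = restrict⁺ R⇒Q p

-- Graphs on n vertices as bit vectors: the row of the first vertex, followed
-- by the code of the graph on the other vertices.

pairs : ℕ → ℕ
pairs zero    = 0
pairs (suc n) = n + pairs n

tail : Graph (Fin (suc n)) → Graph (Fin n)
tail G = record
  { adj     = λ u v → adj G (suc u) (suc v)
  ; adj-sym = λ u v → adj-sym G (suc u) (suc v)
  ; irrefl  = λ v → irrefl G (suc v)
  }

cons : Vec Bool n → Graph (Fin n) → Graph (Fin (suc n))
cons {n} r G = record { adj = a ; adj-sym = a-sym ; irrefl = a-irrefl }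
  where
  a : Fin (suc n) → Fin (suc n) → Bool
  a zero    zero    = false
  a zero    (suc v) = lookupᵛ r v
  a (suc u) zero    = lookupᵛ r u
  a (suc u) (suc v) = adj G u v
  a-sym : ∀ u v → a u v ≡ a v u
  a-sym zero    zero    = refl
  a-sym zero    (suc v) = refl
  a-sym (suc u) zero    = refl
  a-sym (suc u) (suc v) = adj-sym G u v
  a-irrefl : ∀ v → a v v ≡ false
  a-irrefl zero    = refl
  a-irrefl (suc v) = irrefl G v

infix 4 _≗ᴳ_

-- Adjacency is a function, so propositional equality of graphs would call for function
-- extensionality. Pointwise agreement already yields an isomorphism.
_≗ᴳ_ : Graph (Fin n) → Graph (Fin n) → Set
G ≗ᴳ H = ∀ u v → adj G u v ≡ adj H u v

≗⇒≅ : {G H : Graph (Fin n)} → G ≗ᴳ H → G ≅ H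
≗⇒≅ eq = record { bijection = ↔-id _ ; preserves = eq }

-- By symmetry and irreflexivity only the first row has to be compared.
≗-split : {G H : Graph (Fin (suc n))} → (∀ v → adj G zero (suc v) ≡ adj H zero (suc v)) →
          tail G ≗ᴳ tail H → G ≗ᴳ H
≗-split {G = G} {H} row rest zero    zero    = trans (irrefl G zero) (sym (irrefl H zero))
≗-split {G = G} {H} row rest zero    (suc v) = row v
≗-split {G = G} {H} row rest (suc u) zero    =
  trans (adj-sym G (suc u) zero) (trans (row u) (adj-sym H zero (suc u)))
≗-split {G = G} {H} row rest (suc u) (suc v) = rest u v

fromBits : ∀ n → Vec Bool (pairs n) → Graph (Fin n)
fromBits zero    _ = complete 0
fromBits (suc n) b = cons (take n b) (fromBits n (drop n b))

toBits : Graph (Fin n) → Vec Bool (pairs n)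
toBits {zero}  G = []ᵛ
toBits {suc n} G = tabulate (λ v → adj G zero (suc v)) ++ᵛ toBits (tail G)

toBits-cong : (G H : Graph (Fin n)) → G ≗ᴳ H → toBits G ≡ toBits H
toBits-cong {zero}  G H eq = refl
toBits-cong {suc n} G H eq =
  cong₂ _++ᵛ_ (tabulate-cong (eq zero ∘ suc)) (toBits-cong (tail G) (tail H) (λ u v → eq (suc u) (suc v)))

toBits-fromBits : ∀ n (b : Vec Bool (pairs n)) → toBits (fromBits n b) ≡ b
toBits-fromBits zero    []ᵛ = refl
toBits-fromBits (suc n) b = trans
  (cong₂ _++ᵛ_ (tabulate∘lookup (take n b)) (toBits-fromBits n (drop n b)))
  (take++drop≡id n b)

fromBits-injective : ∀ n {b b′} → fromBits n b ≗ᴳ fromBits n b′ → b ≡ b′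
fromBits-injective n {b} {b′} eq = trans (sym (toBits-fromBits n b))
  (trans (toBits-cong (fromBits n b) (fromBits n b′) eq) (toBits-fromBits n b′))

fromBits-toBits : (G : Graph (Fin n)) → fromBits n (toBits G) ≗ᴳ G
fromBits-toBits {zero}  G ()
-- `take++drop≡id` exhibits `toBits G` as a second concatenation, whose pieces must be the first row
-- and the code of `tail G`.
fromBits-toBits {suc n} G with ++-injective (take n (toBits G)) _ (take++drop≡id n (toBits G))
... | row , rest = ≗-split {G = fromBits (suc n) (toBits G)} {G}
  (λ v → trans (cong (λ r → lookupᵛ r v) row) (lookup∘tabulate _ v))
  (λ u v → trans (cong (λ b → adj (fromBits n b) u v) rest) (fromBits-toBits (tail G) u v))

-- Finiteness of the set of isomorphism classes.

graphs : ∀ n → List (Graph (Fin n))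
-- A `Subset` is a vector of booleans, so `subsets` also lists the codes.
graphs n = map (fromBits n) (subsets (pairs n))

graphs-enumerates : Enumerates.IsEnumeration (𝒢 n) (graphs n)
graphs-enumerates G = Any.map (λ { refl → ≅-sym (≗⇒≅ (fromBits-toBits G)) })
  (∈-map⁺ (fromBits _) (∈-subsets (toBits G)))

-- Both directions of an isomorphism are sought among the finitely many maps coded by `funToFin`.
-- Decoding returns a map only pointwise, hence `to≗` and `from≗`.
_≅?_ : (G H : Graph (Fin n)) → Dec (G ≅ H)
_≅?_ {n} G H = map′ fwd bwd (Fin.any? λ i → Fin.any? λ j → iso? (finToFun i) (finToFun j))
  where
  Iso : (f g : Fin n → Fin n) → Set
  Iso f g = (∀ y → f (g y) ≡ y) × (∀ x → g (f x) ≡ x) × (∀ u v → adj G u v ≡ adj H (f u) (f v))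
  iso? : ∀ f g → Dec (Iso f g)
  iso? f g = Fin.all? (λ _ → _ Fin.≟ _) ×-dec Fin.all? (λ _ → _ Fin.≟ _) ×-dec
    Fin.all? λ _ → Fin.all? λ _ → _ Bool.≟ _
  fwd : ∃[ i ] ∃[ j ] Iso (finToFun i) (finToFun j) → G ≅ H
  fwd (i , j , fg , gf , pres) = record
    { bijection = mk↔ₛ′ (finToFun i) (finToFun j) fg gf ; preserves = pres }
  bwd : G ≅ H → ∃[ i ] ∃[ j ] Iso (finToFun i) (finToFun j)
  bwd e = funToFin to , funToFin from
    , (λ y → trans (to≗ _) (trans (cong to (from≗ y)) (strictlyInverseˡ y)))
    , (λ x → trans (from≗ _) (trans (cong from (to≗ x)) (strictlyInverseʳ x)))
    , (λ u v → trans (preserves u v) (sym (cong₂ (adj H) (to≗ u) (to≗ v))))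
    where
    open _≅_ e
    to≗   = Fin.finToFun-funToFin to
    from≗ = Fin.finToFun-funToFin from

𝒢-decSetoid : ℕ → DecSetoid 0ℓ 0ℓ
𝒢-decSetoid n = record
  { isDecEquivalence = record { isEquivalence = Setoid.isEquivalence (𝒢 n) ; _≟_ = _≅?_ } }

Invariant : (∀ {n} → Graph (Fin n) → Set) → Set
Invariant Q = ∀ {n} {G H : Graph (Fin n)} → G ≅ H → Q G → Q H

𝒢[]-finite : (Q : ∀ {n} → Graph (Fin n) → Set) → Invariant Q → (∀ {n} (G : Graph (Fin n)) → Dec (Q G)) →
             ∀ n → ∃[ k ] HasCardinality (𝒢[ Q ] n) k
𝒢[]-finite Q inv Q? n = _ , enumeration⇒card (On.decSetoid (𝒢-decSetoid n) proj₁)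
  {restrict Q? (graphs n)} (λ { (G , q) → restrict⁺ Q? (λ e → inv e q) (graphs-enumerates G) })

-- Invariance of `Q` forbids an isomorphism between the two kinds of representatives, and its
-- decidability assigns every graph to one kind.
𝒢-card-+ : (Q : ∀ {n} → Graph (Fin n) → Set) → Invariant Q → (∀ {n} (G : Graph (Fin n)) → Dec (Q G)) →
           ∀ {n k l} → HasCardinality (𝒢[ (λ G → ¬ Q G) ] n) k → HasCardinality (𝒢[ Q ] n) l →
           HasCardinality (𝒢 n) (k + l)
𝒢-card-+ Q inv Q? {n} {k} {l} b c = record
  { to = rep ∘ splitAt k ; cong = λ { refl → ≅-refl }
  ; bijective = (λ {x} {y} e → trans (sym (Fin.join-splitAt k l x))
      (trans (cong (join k l) (rep-injective (splitAt k x) (splitAt k y) e)) (Fin.join-splitAt k l y)))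
    , λ G → join k l (proj₁ (rep-surjective G)) , λ { refl →
        subst (λ x → rep x ≅ G) (sym (Fin.splitAt-join k l (proj₁ (rep-surjective G)))) (proj₂ (rep-surjective G)) }
  }
  where
  module B = Bijection b
  module C = Bijection c
  rep : Fin k ⊎ Fin l → Graph (Fin n)
  rep (inj₁ i) = proj₁ (B.to i)
  rep (inj₂ j) = proj₁ (C.to j)
  rep-injective : ∀ x y → rep x ≅ rep y → x ≡ y
  rep-injective (inj₁ i) (inj₁ j) e = cong inj₁ (B.injective e)
  rep-injective (inj₁ i) (inj₂ j) e = contradiction (inv (≅-sym e) (proj₂ (C.to j))) (proj₂ (B.to i))
  rep-injective (inj₂ i) (inj₁ j) e = contradiction (inv e (proj₂ (C.to i))) (proj₂ (B.to j))
  rep-injective (inj₂ i) (inj₂ j) e = cong inj₂ (C.injective e)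
  rep-surjective : ∀ G → ∃[ x ] rep x ≅ G
  rep-surjective G with Q? G
  ... | no ¬q = inj₁ (proj₁ (B.strictlySurjective (G , ¬q))) , proj₂ (B.strictlySurjective (G , ¬q))
  ... | yes q = inj₂ (proj₁ (C.strictlySurjective (G , q))) , proj₂ (C.strictlySurjective (G , q))

-- Deciding whether a graph has a mate.

_≋?_ : (p q : Polynomial) → Dec (p ≋ q)
p ≋? q = map′ fwd (λ eq {i} _ → eq i)
  (ℕ.allUpTo? (λ i → coeff p i ℤ.≟ coeff q i) (suc (d ⊔ d′)))
  where
  d  = proj₁ (finite p)
  d′ = proj₁ (finite q)
  fwd : (∀ {i} → i < suc (d ⊔ d′) → coeff p i ≡ coeff q i) → p ≋ q
  fwd eq i with i ≤? d ⊔ d′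
  ... | yes i≤ = eq (s≤s i≤)
  ... | no  i≰ = trans
    (proj₂ (finite p) i (ℕ.≤-<-trans (ℕ.m≤m⊔n d d′) (ℕ.≰⇒> i≰)))
    (sym (proj₂ (finite q) i (ℕ.≤-<-trans (ℕ.m≤n⊔m d d′) (ℕ.≰⇒> i≰))))

-- A mate may a priori have any number of vertices. This condition confines it to the order of the
-- graph, which makes the search in `HasMate?` finite.
DeterminesOrder : GraphPolynomial → Set
DeterminesOrder P = ∀ {m n} (G : Graph (Fin m)) (H : Graph (Fin n)) → poly P G ≋ poly P H → m ≡ n

HasMate-invariant : ∀ P → Invariant (HasMate P)
HasMate-invariant P e (m , K , eq , K≇G) =
  m , K , (λ i → trans (sym (invariant P e i)) (eq i)) , λ K≅H → K≇G (≅-trans K≅H (≅-sym e))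

HasMate? : ∀ P → DeterminesOrder P → (G : Graph (Fin n)) → Dec (HasMate P G)
HasMate? {n} P order G = map′ fwd bwd
  (any? (λ H → (poly P G ≋? poly P H) ×-dec ¬? (H ≅? G)) (graphs n))
  where
  fwd : Any (λ H → IsMate P H G) (graphs n) → HasMate P G
  fwd p with find p
  ... | H , _ , mate = n , H , mate
  bwd : HasMate P G → Any (λ H → IsMate P H G) (graphs n)
  bwd (m , H , eq , H≇G) with order G H eq
  -- The given mate need not be listed itself, but a graph isomorphic to it is, and being a mate
  -- passes to that graph.
  ... | refl = Any.map
    (λ H≅K → (λ i → trans (eq i) (invariant P H≅K i)) , λ K≅G → H≇G (≅-trans H≅K K≅G))
    (graphs-enumerates H)

-- The linear coefficient of the independence polynomial.

length-filter-map : ∀ {A B : Set} {P : B → Set} (P? : Decidable P) (f : A → B) (xs : List A) →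
                    length (filter P? (map f xs)) ≡ length (filter (P? ∘ f) xs)
length-filter-map P? f [] = refl
length-filter-map P? f (x ∷ xs) with ih ← length-filter-map P? f xs | does (P? (f x))
... | true  = cong suc ih
... | false = ih

#subsets-suc : {P : Subset (suc n) → Set} (P? : Decidable P) →
               #subsets P? ≡ #subsets (P? ∘ (outside ∷ᵛ_)) + #subsets (P? ∘ (inside ∷ᵛ_))
#subsets-suc {n} P? = trans
  (cong length (filter-++ P? (map (outside ∷ᵛ_) (subsets n)) _))
  (trans (length-++ (filter P? (map (outside ∷ᵛ_) (subsets n))))
    (cong₂ _+_ (length-filter-map P? (outside ∷ᵛ_) (subsets n))
               (length-filter-map P? (inside ∷ᵛ_) (subsets n))))

#subsets-≐ : {P Q : Subset n → Set} (P? : Decidable P) (Q? : Decidable Q) →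
             (∀ {A} → P A → Q A) → (∀ {A} → Q A → P A) → #subsets P? ≡ #subsets Q?
#subsets-≐ {n} P? Q? P⇒Q Q⇒P = cong length (filter-≐ P? Q? (P⇒Q , Q⇒P) (subsets n))

#∣∣≡0 : ∀ n → #subsets {n} (λ A → ∣ A ∣ ℕ.≟ 0) ≡ 1
#∣∣≡0 zero    = refl
#∣∣≡0 (suc n) = trans (#subsets-suc {n} (λ A → ∣ A ∣ ℕ.≟ 0)) (cong₂ _+_ (#∣∣≡0 n)
  (#subsets-none {n} (λ A → suc ∣ A ∣ ℕ.≟ 0) (λ _ ())))

#∣∣≡1 : ∀ n → #subsets {n} (λ A → ∣ A ∣ ℕ.≟ 1) ≡ n
#∣∣≡1 zero    = refl
#∣∣≡1 (suc n) = trans (#subsets-suc {n} (λ A → ∣ A ∣ ℕ.≟ 1)) (trans (cong₂ _+_ (#∣∣≡1 n)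
  (trans (#subsets-≐ {n} (λ A → suc ∣ A ∣ ℕ.≟ 1) (λ A → ∣ A ∣ ℕ.≟ 0) ℕ.suc-injective (cong suc)) (#∣∣≡0 n)))
  (ℕ.+-comm n 1))

∣∣≡1⇒edgeless : (G : Graph (Fin n)) (A : Subset n) → ∣ A ∣ ≡ 1 → Edgeless (G [ A ])
∣∣≡1⇒edgeless G A ∣A∣≡1 u v = subst (λ w → adj (G [ A ]) u w ≡ false) u≡v (irrefl (G [ A ]) u)
  where
  open Inverse (elements↔ A)
  Fin1-prop : ∀ {k} → k ≡ 1 → (i j : Fin k) → i ≡ j
  Fin1-prop refl zero zero = refl
  u≡v : u ≡ v
  u≡v = trans (sym (strictlyInverseˡ u))
    (trans (cong to (Fin1-prop ∣A∣≡1 (from u) (from v))) (strictlyInverseˡ v))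

-- Single vertices are always independent, so only the size condition matters.
s₁≡n : (G : Graph (Fin n)) → s 1 G ≡ n
s₁≡n {n} G = trans
  (#subsets-≐ (λ A → (∣ A ∣ ℕ.≟ 1) ×-dec edgeless? G A) (λ A → ∣ A ∣ ℕ.≟ 1)
    proj₁ (λ {A} ∣A∣≡1 → ∣A∣≡1 , ∣∣≡1⇒edgeless G A ∣A∣≡1))
  (#∣∣≡1 n)

Ind-order : DeterminesOrder Ind
Ind-order G H eq = trans (sym (s₁≡n G)) (trans (ℤ.+-injective (eq 1)) (s₁≡n H))

-- Complementation.

co : Graph (Fin n) → Graph (Fin n)
co {n} G = record
  { adj     = λ u v → adj (complete n) u v ∧ not (adj G u v)
  ; adj-sym = λ u v → cong₂ (λ a b → a ∧ not b) (adj-sym (complete n) u v) (adj-sym G u v)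
  ; irrefl  = λ v → cong (_∧ not (adj G v v)) (irrefl (complete n) v)
  }

adj-bounded : (G : Graph (Fin n)) → ∀ u v → adj (complete n) u v ≡ false → adj G u v ≡ false
adj-bounded G u v eq with u Fin.≟ v
... | yes refl = irrefl G u
... | no _ with () ← eq

co-co : (G : Graph (Fin n)) → co (co G) ≗ᴳ G
co-co {n} G u v with adj (complete n) u v | adj-bounded G u v
... | true  | _ = Bool.not-involutive (adj G u v)
... | false | b = sym (b refl)

co-co-≅ : (G : Graph (Fin n)) → co (co G) ≅ G
co-co-≅ G = ≗⇒≅ (co-co G)

co-cong : {G : Graph (Fin m)} {H : Graph (Fin n)} → G ≅ H → co G ≅ co H
co-cong {m} {n} {G} {H} e = record
  { bijection = bijection
  ; preserves = λ u v → cong₂ (λ a b → a ∧ not b) (complete≡ u v) (preserves u v)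
  }
  where
  open _≅_ e
  complete≡ : ∀ u v → adj (complete m) u v ≡ adj (complete n) (to u) (to v)
  complete≡ u v with u Fin.≟ v
  ... | yes u≡v = cong not (sym (dec-true (to u Fin.≟ to v) (cong to u≡v)))
  ... | no  u≢v = cong not (sym (dec-false (to u Fin.≟ to v) λ eq → u≢v
          (trans (sym (strictlyInverseʳ u)) (trans (cong from eq) (strictlyInverseʳ v)))))

co-injective : {G : Graph (Fin m)} {H : Graph (Fin n)} → co G ≅ co H → G ≅ H
co-injective {G = G} {H} e = ≅-trans (≅-sym (co-co-≅ G)) (≅-trans (co-cong e) (co-co-≅ H))

-- ≅complete? decides by testing ∣A∣ ≡ i and comparing the adjacencies on A with
-- those of the complete graph, so its verdict characterises G [ A ] ≅ complete i.
c≡s∘co : (G : Graph (Fin n)) → ∀ i → c i G ≡ s i (co G)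
c≡s∘co {n} G i = #subsets-≐ (λ A → ≅complete? G A i) (λ A → (∣ A ∣ ℕ.≟ i) ×-dec edgeless? (co G) A)
  (λ {A} → fwd A) (λ {A} → bwd A)
  where
  clique? : ∀ A → Dec (∣ A ∣ ≡ i × (∀ (u v : ∃[ w ] w ∈ A) →
                       adj G (proj₁ u) (proj₁ v) ≡ adj (complete n) (proj₁ u) (proj₁ v)))
  clique? A = (∣ A ∣ ℕ.≟ i) ×-dec all∈? A (λ u v → adj G u v Bool.≟ adj (complete n) u v)
  fwd : ∀ A → G [ A ] ≅ complete i → ∣ A ∣ ≡ i × Edgeless (co G [ A ])
  fwd A e with proof (clique? A) | dec-true (≅complete? G A i) e
  ... | p | eq with invert (subst (Reflects _) eq p)
  ... | ∣A∣≡i , same = ∣A∣≡i , λ u v → trans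
    (cong (λ a → adj (complete n) (proj₁ u) (proj₁ v) ∧ not a) (same u v))
    (Bool.∧-inverseʳ (adj (complete n) (proj₁ u) (proj₁ v)))
  bwd : ∀ A → ∣ A ∣ ≡ i × Edgeless (co G [ A ]) → G [ A ] ≅ complete i
  bwd A (∣A∣≡i , E) = invert (subst (Reflects _) (dec-true (clique? A) (∣A∣≡i , same)) (proof (≅complete? G A i)))
    where
    same : ∀ (u v : ∃[ w ] w ∈ A) → adj G (proj₁ u) (proj₁ v) ≡ adj (complete n) (proj₁ u) (proj₁ v)
    same (u , p) (v , q) with adj (complete n) u v | adj-bounded G u v | E (u , p) (v , q)
    ... | true  | _ | eq = Bool.not-injective eq
    ... | false | b | _  = b refl

Ind-co : (G : Graph (Fin n)) → poly Ind (co G) ≋ poly Cl G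
Ind-co G zero    = refl
Ind-co G (suc i) = cong +_ (sym (c≡s∘co G (suc i)))

Cl-co : (G : Graph (Fin n)) → poly Cl (co G) ≋ poly Ind G
Cl-co G i = trans (sym (Ind-co (co G) i)) (invariant Ind (co-co-≅ G) i)

HasMate-co : ∀ P P′ → (∀ {n} (G : Graph (Fin n)) → poly P′ (co G) ≋ poly P G) →
             (G : Graph (Fin n)) → HasMate P G → HasMate P′ (co G)
HasMate-co P P′ eq G (m , H , mate , H≇G) =
  m , co H , (λ i → trans (eq G i) (trans (mate i) (sym (eq H i)))) , H≇G ∘ co-injective

-- Up to isomorphism `co` is an involution that keeps the order, so it matches the classes with `Q`
-- to those with `Q′`, and all cardinalities carry over.
HasDensity-co : {Q Q′ : ∀ {n} → Graph (Fin n) → Set} →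
                (∀ {n} (G : Graph (Fin n)) → Q G → Q′ (co G)) →
                (∀ {n} (G : Graph (Fin n)) → Q′ G → Q (co G)) →
                ∀ {ℓ} → HasDensity 𝒢[ Q ] ℓ → HasDensity 𝒢[ Q′ ] ℓ
HasDensity-co {Q} {Q′} Q⇒Q′ Q′⇒Q d = record
  { ∣S∣ = ∣S∣ ; ∣𝒢∣ = ∣𝒢∣ ; ∣S∣-card = card ; ∣𝒢∣-card = ∣𝒢∣-card ; limit = limit }
  where
  open HasDensity d
  card : ∀ n → HasCardinality (𝒢[ Q′ ] n) (∣S∣ n)
  card n = record
    { to        = λ i → co (proj₁ (to i)) , Q⇒Q′ _ (proj₂ (to i))
    ; cong      = λ { refl → ≅-refl }
    ; bijective = injective ∘ co-injective
                , λ { (G , q) → proj₁ (strictlySurjective (co G , Q′⇒Q G q)) , λ { refl →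
                      ≅-trans (co-cong (proj₂ (strictlySurjective (co G , Q′⇒Q G q)))) (co-co-≅ G) } }
    }
    where open Bijection (∣S∣-card n)

-- Lower bound for the number of isomorphism classes.

length-subsets : ∀ n → length (subsets n) ≡ 2 ^ n
length-subsets zero    = refl
length-subsets (suc n) = trans (length-++ (map (outside ∷ᵛ_) (subsets n)))
  (cong₂ _+_ (trans (length-map (outside ∷ᵛ_) (subsets n)) (length-subsets n))
    (trans (trans (length-map (inside ∷ᵛ_) (subsets n)) (length-subsets n)) (sym (ℕ.+-identityʳ (2 ^ n)))))

bitsToFin : Vec Bool n → Fin (2 ^ n)
bitsToFin {n} b = subst Fin (length-subsets n) (index (∈-subsets b))

bitsToFin-injective : {b b′ : Vec Bool n} → bitsToFin b ≡ bitsToFin b′ → b ≡ b′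
bitsToFin-injective {n} {b} {b′} eq = trans (lookup-index (∈-subsets b))
  (trans (cong (lookup (subsets n)) (subst-injective (length-subsets n) eq))
    (sym (lookup-index (∈-subsets b′))))

-- A labelled graph is recovered from the representative of its class and the vertex map of an
-- isomorphism from that representative. There are at most `n ^ n` such maps.
2^pairs≤∣𝒢∣*n^n : ∀ n {g} → HasCardinality (𝒢 n) g → 2 ^ pairs n ≤ g * n ^ n
2^pairs≤∣𝒢∣*n^n n {g} b = subst (_≤ g * n ^ n) (length-subsets (pairs n))
  (Fin.injective⇒≤ {f = code} λ {i} {j} → code-injective i j)
  where
  open Bijection b using (to; strictlySurjective)
  graph : Fin (length (subsets (pairs n))) → Graph (Fin n)
  graph i = fromBits n (lookup (subsets (pairs n)) i)
  class : Fin (length (subsets (pairs n))) → Fin g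
  class i = proj₁ (strictlySurjective (graph i))
  iso : ∀ i → to (class i) ≅ graph i
  iso i = proj₂ (strictlySurjective (graph i))
  code : Fin (length (subsets (pairs n))) → Fin (g * n ^ n)
  code i = combine (class i) (funToFin (_≅_.to (iso i)))
  -- Going back along `e` and forth along `f` fixes every vertex, so the composite isomorphism
  -- compares adjacencies of the same pairs.
  transport : ∀ {R R′ G H : Graph (Fin n)} (e : R ≅ G) (f : R′ ≅ H) → R ≡ R′ →
              (∀ v → _≅_.to e v ≡ _≅_.to f v) → G ≗ᴳ H
  transport {R} {G = G} {H} e f refl to≗ u v = trans (_≅_.preserves (≅-sym e) u v)
    (trans (_≅_.preserves f _ _) (cong₂ (adj H) (f∘e⁻¹ u) (f∘e⁻¹ v)))
    where
    f∘e⁻¹ : ∀ w → _≅_.to f (_≅_.from e w) ≡ w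
    f∘e⁻¹ w = trans (sym (to≗ _)) (_≅_.strictlyInverseˡ e w)
  code-injective : ∀ i j → code i ≡ code j → i ≡ j
  code-injective i j eq with Fin.combine-injective (class i) _ (class j) _ eq
  ... | class≡ , fun≡ = lookup-injective (setoid _) (subsets-unique (pairs n)) (fromBits-injective n
    (transport (iso i) (iso j) (cong to class≡) λ v →
      trans (sym (Fin.finToFun-funToFin (_≅_.to (iso i)) v))
        (trans (cong (λ x → finToFun x v) fun≡) (Fin.finToFun-funToFin (_≅_.to (iso j)) v))))

-- Graphs with a prescribed independent set.

-- An outer pair of A is a pair of vertices that are not both in A.
outerPairs : Subset n → ℕ
outerPairs         []ᵛ            = 0
outerPairs {suc n} (outside ∷ᵛ A) = n + outerPairs A
outerPairs         (inside ∷ᵛ A)  = ∣ ∁ A ∣ + outerPairs A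

-- The later vertices paired with a vertex of `A` split into the rest of `A`, counted by
-- `pairs ∣ A ∣`, and its complement, counted by `outerPairs A`.
outerPairs+pairs : (A : Subset n) → outerPairs A + pairs ∣ A ∣ ≡ pairs n
outerPairs+pairs []ᵛ            = refl
outerPairs+pairs {suc n} (outside ∷ᵛ A) =
  trans (ℕ.+-assoc n (outerPairs A) _) (cong (λ j → n + j) (outerPairs+pairs A))
outerPairs+pairs {suc n} (inside ∷ᵛ A) = trans
  (interchange (∣ ∁ A ∣) (outerPairs A) (∣ A ∣) (pairs ∣ A ∣))
  (cong₂ _+_ (trans (cong (_+ ∣ A ∣) (∣∁p∣≡n∸∣p∣ A)) (ℕ.m∸n+n≡m (∣p∣≤n A))) (outerPairs+pairs A))
  where
  interchange : ∀ a b c d → (a + b) + (c + d) ≡ (a + c) + (b + d)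
  interchange = solve-∀

pairs-mono-≤ : m ≤ n → pairs m ≤ pairs n
pairs-mono-≤ z≤n       = z≤n
pairs-mono-≤ (s≤s m≤n) = ℕ.+-mono-≤ m≤n (pairs-mono-≤ m≤n)

outerPairs≤ : ∀ {k} (A : Subset n) → k ≤ ∣ A ∣ → outerPairs A ≤ pairs n ∸ pairs k
outerPairs≤ {k = k} A k≤ = ℕ.m+n≤o⇒m≤o∸n (outerPairs A)
  (ℕ.≤-trans (ℕ.+-monoʳ-≤ (outerPairs A) (pairs-mono-≤ k≤)) (ℕ.≤-reflexive (outerPairs+pairs A)))

outerBits : (A : Subset n) → Graph (Fin n) → Vec Bool (outerPairs A)
outerBits []ᵛ            G = []ᵛ
outerBits (outside ∷ᵛ A) G = tabulate (λ v → adj G zero (suc v)) ++ᵛ outerBits A (tail G)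
outerBits (inside ∷ᵛ A)  G =
  tabulate (λ i → adj G zero (suc (proj₁ (Inverse.to (elements↔ (∁ A)) i)))) ++ᵛ outerBits A (tail G)

tabulate-injective : ∀ {A : Set} {f g : Fin n → A} → tabulate f ≡ tabulate g → ∀ i → f i ≡ g i
tabulate-injective {f = f} {g} eq i = trans (sym (lookup∘tabulate f i))
  (trans (cong (λ xs → lookupᵛ xs i) eq) (lookup∘tabulate g i))

-- The entries that `outerBits` omits belong to pairs inside `A`, where neither graph has an edge.
outerBits-injective : (A : Subset n) (G H : Graph (Fin n)) → Edgeless (G [ A ]) → Edgeless (H [ A ]) →
                      outerBits A G ≡ outerBits A H → G ≗ᴳ H
outerBits-injective []ᵛ            G H EG EH eq ()
outerBits-injective (outside ∷ᵛ A) G H EG EH eq with ++-injective (tabulate _) _ eq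
... | row , rest = ≗-split {G = G} {H} (tabulate-injective row)
  (outerBits-injective A (tail G) (tail H)
    (λ { (u , p) (v , q) → EG (suc u , there p) (suc v , there q) })
    (λ { (u , p) (v , q) → EH (suc u , there p) (suc v , there q) }) rest)
outerBits-injective (inside ∷ᵛ A)  G H EG EH eq with ++-injective (tabulate _) _ eq
... | row , rest = ≗-split {G = G} {H} row≗
  (outerBits-injective A (tail G) (tail H)
    (λ { (u , p) (v , q) → EG (suc u , there p) (suc v , there q) })
    (λ { (u , p) (v , q) → EH (suc u , there p) (suc v , there q) }) rest)
  where
  open Inverse (elements↔ (∁ A)) using (to; from; strictlyInverseˡ)
  row≗ : ∀ v → adj G zero (suc v) ≡ adj H zero (suc v)
  row≗ v with v ∈? A
  ... | yes v∈A = trans (EG (zero , here) (suc v , there v∈A)) (sym (EH (zero , here) (suc v , there v∈A)))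
  ... | no  v∉A = subst (λ w → adj G zero (suc w) ≡ adj H zero (suc w))
    (cong proj₁ (strictlyInverseˡ (v , x∉p⇒x∈∁p v∉A)))
    (tabulate-injective row (from (v , x∉p⇒x∈∁p v∉A)))

-- Upper bound for the number of `Ind`-unique graphs.

s<2^1+n : ∀ i (G : Graph (Fin n)) → s i G < 2 ^ suc n
s<2^1+n {n} i G = ℕ.≤-<-trans
  (ℕ.≤-trans (length-filter (λ A → (∣ A ∣ ℕ.≟ i) ×-dec edgeless? G A) (subsets n)) (ℕ.≤-reflexive (length-subsets n)))
  -- One bit more than the `2 ^ n` subsets require makes the bound strict, as `fromℕ<` demands in
  -- `profile`.
  (ℕ.^-monoʳ-< 2 (s≤s (s≤s z≤n)) (ℕ.n<1+n n))

HasLarge : ℕ → Graph (Fin n) → Set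
HasLarge k G = ∃[ A ] (k ≤ ∣ A ∣ × Edgeless (G [ A ]))

hasLarge? : ∀ k (G : Graph (Fin n)) → Dec (HasLarge k G)
hasLarge? {n} k G = map′ (λ p → let A , _ , q = find p in A , q) (λ { (A , q) → lose (∈-subsets A) q })
  (any? (λ A → (k ≤? ∣ A ∣) ×-dec edgeless? G A) (subsets n))

module _ (n k : ℕ) where

  #profiles #outerCodes : ℕ
  #profiles = (2 ^ suc n) ^ k
  #outerCodes = 2 ^ n * 2 ^ (pairs n ∸ pairs k)

  profile : Graph (Fin n) → Fin #profiles
  profile G = funToFin {k} λ i → fromℕ< (s<2^1+n (toℕ i) G)

  profile-injective : (G H : Graph (Fin n)) → ¬ HasLarge k G → ¬ HasLarge k H →
                      profile G ≡ profile H → ∀ i → s i G ≡ s i H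
  profile-injective G H ¬G ¬H eq i with i ℕ.<? k
  ... | yes i<k = subst (λ j → s j G ≡ s j H) (Fin.toℕ-fromℕ< i<k)
    (trans (value G) (trans (cong (λ x → toℕ (finToFun {n = k} x (fromℕ< i<k))) eq) (sym (value H))))
    where
    value : ∀ G → s (toℕ (fromℕ< i<k)) G ≡ toℕ (finToFun {n = k} (profile G) (fromℕ< i<k))
    value G = sym (trans (cong toℕ (Fin.finToFun-funToFin {k} _ (fromℕ< i<k)))
      (Fin.toℕ-fromℕ< (s<2^1+n (toℕ (fromℕ< i<k)) G)))
  ... | no  i≮k = trans (vanish G ¬G) (sym (vanish H ¬H))
    where
    vanish : ∀ G → ¬ HasLarge k G → s i G ≡ 0
    vanish G ¬#outerCodes = #subsets-none (λ A → (∣ A ∣ ℕ.≟ i) ×-dec edgeless? G A)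
      λ { A (∣A∣≡i , E) → ¬#outerCodes (A , subst (k ≤_) (sym ∣A∣≡i) (ℕ.≮⇒≥ i≮k) , E) }

  -- The second summand stores `A` as well, since the number and meaning of the outer bits depend on
  -- it; `inject≤` brings them to a common range.
  code : (G : Graph (Fin n)) → Dec (HasLarge k G) → Fin #profiles ⊎ Fin #outerCodes
  code G (no _)             = inj₁ (profile G)
  code G (yes (A , k≤ , _)) = inj₂ (combine (bitsToFin A)
    (inject≤ (bitsToFin (outerBits A G)) (ℕ.^-monoʳ-≤ 2 (outerPairs≤ A k≤))))

  -- In the second summand even the graphs agree: `A` is recovered first, after which both vectors
  -- of outer bits have the same type.
  code-injective : ∀ G H G? H? → code G G? ≡ code H H? → poly Ind G ≋ poly Ind H
  code-injective G H (no _)  (yes _) ()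
  code-injective G H (yes _) (no _)  ()
  code-injective G H (no ¬G) (no ¬H) eq zero    = refl
  code-injective G H (no ¬G) (no ¬H) eq (suc i) =
    cong +_ (profile-injective G H ¬G ¬H (inj₁-injective eq) (suc i))
  code-injective G H (yes (A , k≤ , EG)) (yes (B , _ , EH)) eq
    with Fin.combine-injective (bitsToFin A) _ (bitsToFin B) _ (inj₂-injective eq)
  ... | A≡B , bits≡ with bitsToFin-injective {b = A} {B} A≡B
  ... | refl = invariant Ind (≗⇒≅ {G = G} {H} (outerBits-injective A G H EG EH
    (bitsToFin-injective (Fin.inject≤-injective _ _ _ _ bits≡))))

  -- Representatives with equal codes share their polynomial, so if they were not isomorphic, one
  -- would be a mate of the other. Decidability of isomorphism removes the double negation.
  ∣U-Ind∣≤ : ∀ {u} → HasCardinality (U Ind n) u → u ≤ #profiles + #outerCodes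
  ∣U-Ind∣≤ b = Fin.injective⇒≤ {f = λ i → join #profiles #outerCodes (code (rep i) (hasLarge? k (rep i)))}
    λ {i} {j} eq → injective (decidable-stable (rep i ≅? rep j) λ Gi≇Gj →
      proj₂ (to j) (n , rep i , (λ l → sym (code-injective (rep i) (rep j) (hasLarge? k (rep i)) (hasLarge? k (rep j))
        (join-injective eq) l)) , Gi≇Gj))
    where
    open Bijection b using (to; injective)
    rep : Fin _ → Graph (Fin n)
    rep i = proj₁ (to i)
    join-injective : ∀ {x y} → join #profiles #outerCodes x ≡ join #profiles #outerCodes y → x ≡ y
    join-injective {x} {y} eq = trans (sym (Fin.splitAt-join #profiles #outerCodes x))
      (trans (cong (splitAt #profiles) eq) (Fin.splitAt-join #profiles #outerCodes y))

-- Comparison of the two bounds.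

2*pairs : ∀ n → 2 * pairs n + n ≡ n * n
2*pairs zero    = refl
2*pairs (suc n) = begin
  2 * (n + pairs n) + suc n           ≡⟨ regroup n (pairs n) ⟩
  suc (2 * n) + (2 * pairs n + n)     ≡⟨ cong (λ x → suc (2 * n) + x) (2*pairs n) ⟩
  suc (2 * n) + n * n                 ≡⟨ square n ⟩
  suc n * suc n                       ∎
  where
  open ≡-Reasoning
  regroup : ∀ n p → 2 * (n + p) + suc n ≡ suc (2 * n) + (2 * p + n)
  regroup = solve-∀
  square : ∀ n → suc (2 * n) + n * n ≡ suc n * suc n
  square = solve-∀

-- Doubling avoids the division in `n (n - 1) / 2` and turns the size conditions into polynomial
-- inequalities.
≤pairs : ∀ {x} n → 2 * x + n ≤ n * n → x ≤ pairs n
≤pairs {x} n le = ℕ.*-cancelˡ-≤ 2 (ℕ.+-cancelʳ-≤ n (2 * x) (2 * pairs n)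
  (subst (2 * x + n ≤_) (sym (2*pairs n)) le))

1+n≤2^n : ∀ n → suc n ≤ 2 ^ n
1+n≤2^n zero    = s≤s z≤n
1+n≤2^n (suc n) = ℕ.+-mono-≤ (ℕ.m^n>0 2 n) (ℕ.≤-trans (1+n≤2^n n) (ℕ.m≤m+n (2 ^ n) 0))

-- X bits suffice for n ^ (1 + n), and Y bits for each of the two kinds of codes.
bits-bound : ∀ n k X {g u} → n ^ suc n ≤ 2 ^ X →
             suc n * k + (X + 2) ≤ pairs n → n + (X + 2) ≤ pairs k → k ≤ n →
             2 ^ pairs n ≤ g * n ^ n → u ≤ (2 ^ suc n) ^ k + 2 ^ n * 2 ^ (pairs n ∸ pairs k) →
             n * u < g
bits-bound n k X {g} {u} nX small large k≤n lower upper = ℕ.*-cancelʳ-< (n ^ n) (n * u) g (begin-strict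
  n * u * n ^ n                ≡⟨ regroup n u (n ^ n) ⟩
  n ^ suc n * u                ≤⟨ ℕ.*-mono-≤ nX upper ⟩
  2 ^ X * ((2 ^ suc n) ^ k + 2 ^ n * 2 ^ (pairs n ∸ pairs k))
                               ≤⟨ ℕ.*-monoʳ-≤ (2 ^ X) (ℕ.+-mono-≤ small≤ large≤) ⟩
  2 ^ X * (2 ^ Y + 2 ^ Y)      ≡⟨ collect ⟩
  2 ^ (X + suc Y)              <⟨ ℕ.^-monoʳ-< 2 (s≤s (s≤s z≤n)) (ℕ.≤-reflexive total) ⟩
  2 ^ pairs n                  ≤⟨ lower ⟩
  g * n ^ n                    ∎)
  where
  open ℕ.≤-Reasoning
  -- Of the two spare bits, one pays for adding two equal powers and the other for strictness.
  Y = pairs n ∸ (X + 2)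
  regroup : ∀ a b c → a * b * c ≡ a * c * b
  regroup = solve-∀
  collect : 2 ^ X * (2 ^ Y + 2 ^ Y) ≡ 2 ^ (X + suc Y)
  collect = trans (cong (λ x → 2 ^ X * (2 ^ Y + x)) (sym (ℕ.+-identityʳ (2 ^ Y))))
    (sym (ℕ.^-distribˡ-+-* 2 X (suc Y)))
  total : suc (X + suc Y) ≡ pairs n
  total = trans (shift X Y) (ℕ.m∸n+n≡m (ℕ.≤-trans (ℕ.m≤n+m (X + 2) (suc n * k)) small))
    where
    shift : ∀ X Y → suc (X + suc Y) ≡ Y + (X + 2)
    shift = solve-∀
  small≤ : (2 ^ suc n) ^ k ≤ 2 ^ Y
  small≤ = subst (_≤ 2 ^ Y) (sym (ℕ.^-*-assoc 2 (suc n) k))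
    (ℕ.^-monoʳ-≤ 2 (ℕ.m+n≤o⇒m≤o∸n (suc n * k) small))
  large≤ : 2 ^ n * 2 ^ (pairs n ∸ pairs k) ≤ 2 ^ Y
  large≤ = subst (_≤ 2 ^ Y) (ℕ.^-distribˡ-+-* 2 n (pairs n ∸ pairs k))
    (ℕ.^-monoʳ-≤ 2 (ℕ.m+n≤o⇒m≤o∸n (n + (pairs n ∸ pairs k)) (begin
      n + (pairs n ∸ pairs k) + (X + 2)   ≡⟨ swap n (pairs n ∸ pairs k) (X + 2) ⟩
      (pairs n ∸ pairs k) + (n + (X + 2)) ≤⟨ ℕ.+-monoʳ-≤ (pairs n ∸ pairs k) large ⟩
      (pairs n ∸ pairs k) + pairs k       ≡⟨ ℕ.m∸n+n≡m (pairs-mono-≤ k≤n) ⟩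
      pairs n                             ∎)))
    where
    swap : ∀ a b c → a + b + c ≡ b + (a + c)
    swap = solve-∀

-- With t = ⌊n / 64⌋ and k = 16 t the binomial k(k-1)/2 ≈ 128 t² exceeds
-- n log n ≲ 64 t², while k n ≈ 1024 t² stays below n² / 2 ≈ 2048 t².
∣U∣-bound : ∀ n → n ≥ 576 → ∀ {g u} → HasCardinality (𝒢 n) g → HasCardinality (U Ind n) u → n * u < g
∣U∣-bound n n≥ bg bu = go (n ℕ./ 64) (n ℕ.% 64) (ℕ.m≡m%n+[m/n]*n n 64) (ℕ.≤-pred (ℕ.m%n<n n 64))
  (ℕ./-monoˡ-≤ 64 n≥) bg bu
  where
  -- Quotient and remainder become free variables, so that the equation for `n` can be matched with
  -- `refl`.
  go : ∀ {n} t r → n ≡ r + t * 64 → r ≤ 63 → 9 ≤ t →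
       ∀ {g u} → HasCardinality (𝒢 n) g → HasCardinality (U Ind n) u → n * u < g
  -- With `t = 9 + a` the remainders in `expand-n` and `expand-k` have nonnegative coefficients. The
  -- inequality behind `expand-k` fails for `t = 8`; this is the source of the threshold
  -- `576 = 9 * 64`.
  go {n} t r refl r≤ 9≤t with ℕ.m≤n⇒∃[o]m+o≡n 9≤t
  ... | a , refl = λ bg bu → bits-bound n k X pow
          (≤pairs n (subst (2 * (suc n * k + (X + 2)) + n ≤_) (sym (expand-n a r)) (ℕ.m≤m+n _ _)))
          (≤pairs k (ℕ.≤-trans (ℕ.+-monoˡ-≤ k (ℕ.*-monoʳ-≤ 2 le))
            (subst (2 * (N + ((t + 6) * suc N + 2)) + k ≤_) (sym (expand-k a)) (ℕ.m≤m+n _ _))))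
          (ℕ.≤-trans (ℕ.*-monoʳ-≤ t (ℕ.m≤m+n 16 48)) (ℕ.m≤n+m (t * 64) r))
          (2^pairs≤∣𝒢∣*n^n n bg) (∣U-Ind∣≤ n k bu)
    where
    k = t * 16
    -- From `n < 64 (t + 1)` and `t + 1 ≤ 2 ^ t` follows `n ≤ 2 ^ (t + 6)`.
    X = (t + 6) * suc n
    -- The largest value of `n` with quotient `t`; passing to it removes `r` from the inequality for
    -- `pairs k`.
    N = 63 + t * 64
    le : n + (X + 2) ≤ N + ((t + 6) * suc N + 2)
    le = ℕ.+-mono-≤ n≤N (ℕ.+-monoˡ-≤ 2 (ℕ.*-monoʳ-≤ (t + 6) (s≤s n≤N)))
      where
      n≤N : n ≤ N
      n≤N = ℕ.+-monoˡ-≤ (t * 64) r≤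
    expand-n : ∀ a r → let t = 9 + a; n = r + t * 64 in n * n ≡
      2 * (suc n * (t * 16) + ((t + 6) * suc n + 2)) + n +
      (1920 * a * a + 33694 * a + 147710 + 94 * a * r + 833 * r + r * r)
    expand-n = solve-∀
    expand-k : ∀ a → let t = 9 + a; N = 63 + t * 64 in (t * 16) * (t * 16) ≡
      2 * (N + ((t + 6) * suc N + 2)) + t * 16 + (128 * a * a + 1264 * a + 110)
    expand-k = solve-∀
    pow : n ^ suc n ≤ 2 ^ X
    pow = subst (n ^ suc n ≤_) (ℕ.^-*-assoc 2 (t + 6) (suc n)) (ℕ.^-monoˡ-≤ (suc n) (begin
      r + t * 64     ≤⟨ ℕ.+-monoˡ-≤ (t * 64) (ℕ.m≤n⇒m≤1+n r≤) ⟩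
      suc t * 64     ≤⟨ ℕ.*-monoˡ-≤ 64 (1+n≤2^n t) ⟩
      2 ^ t * 2 ^ 6  ≡⟨ ℕ.^-distribˡ-+-* 2 t 6 ⟨
      2 ^ (t + 6)    ∎))
      where open ℕ.≤-Reasoning

-- Limits of the ratios.

mkℚᵘ< : ∀ k d ε → 0ℚᵘ <ℚ ε → ↧ₙ ε * k < suc d → mkℚᵘ (+ k) d <ℚ ε
mkℚᵘ< k d (mkℚᵘ (+ zero)  q) (*<* (+<+ ())) _
-- A positive `ε` has numerator at least 1, so it is no smaller than the reciprocal of its
-- denominator, with which the hypothesis compares.
mkℚᵘ< k d (mkℚᵘ (+ suc p) q) _ lt = *<* (subst₂ ℤ._<_ (ℤ.pos-* k (suc q)) (ℤ.pos-* (suc p) (suc d))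
  (+<+ (ℕ.<-≤-trans (subst (_< suc d) (ℕ.*-comm (suc q) k) lt) (ℕ.m≤n*m (suc d) (suc p)))))

∣k/g-0∣<ε : ∀ k g .{{_ : NonZero g}} ε → 0ℚᵘ <ℚ ε → ↧ₙ ε * k < g → ∣ + k / g - 0ℚᵘ ∣ℚ <ℚ ε
∣k/g-0∣<ε k g@(suc _) ε 0<ε lt = mkℚᵘ< _ _ ε 0<ε (subst₂ (λ x d → ↧ₙ ε * x < d)
  (sym (cong ℤ.∣_∣ (trans (ℤ.+-identityʳ _) (ℤ.*-identityʳ (+ k))))) (sym (ℕ.*-identityʳ g)) lt)

-- The distance to 1 equals `k / (k + l)`.
∣l/[k+l]-1∣<ε : ∀ k l .{{_ : NonZero (k + l)}} ε → 0ℚᵘ <ℚ ε → ↧ₙ ε * k < k + l →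
                ∣ + l / (k + l) - 1ℚᵘ ∣ℚ <ℚ ε
∣l/[k+l]-1∣<ε k l ε 0<ε lt = go (k + l) refl lt
  where
  open ≡-Reasoning
  -- The sum is abstracted to `g`, which can be matched with `suc` so that the quotient computes.
  go : ∀ g .{{_ : NonZero g}} → g ≡ k + l → ↧ₙ ε * k < g → ∣ + l / g - 1ℚᵘ ∣ℚ <ℚ ε
  go g@(suc _) eq lt = mkℚᵘ< _ _ ε 0<ε (subst₂ (λ x d → ↧ₙ ε * x < d) (sym numerator) (sym (ℕ.*-identityʳ g)) lt)
    where
    numerator : ℤ.∣ + l ℤ.* + 1 ℤ.+ (ℤ.- + 1) ℤ.* + g ∣ ≡ k
    numerator = begin
      ℤ.∣ + l ℤ.* + 1 ℤ.+ (ℤ.- + 1) ℤ.* + g ∣ ≡⟨ cong ℤ.∣_∣ (cong₂ ℤ._+_ (ℤ.*-identityʳ (+ l)) (ℤ.-1*i≡-i (+ g))) ⟩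
      ℤ.∣ + l ℤ.- + g ∣                       ≡⟨ ℤ.∣i-j∣≡∣j-i∣ (+ l) (+ g) ⟩
      ℤ.∣ + g ℤ.- + l ∣                       ≡⟨ cong (λ x → ℤ.∣ + x ℤ.- + l ∣) eq ⟩
      ℤ.∣ + (k + l) ℤ.- + l ∣                 ≡⟨ cong ℤ.∣_∣ (ℤ.m-n≡m⊖n (k + l) l) ⟩
      ℤ.∣ (k + l) ℤ.⊖ l ∣                     ≡⟨ cong ℤ.∣_∣ (ℤ.⊖-≥ (ℕ.m≤n+m l k)) ⟩
      k + l ∸ l                               ≡⟨ ℕ.m+n∸n≡m k l ⟩
      k                                       ∎

-- Conclusion for both polynomials.

module _ (n : ℕ) where

  private
    hasMate? : ∀ {n} (G : Graph (Fin n)) → Dec (HasMate Ind G)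
    hasMate? = HasMate? Ind Ind-order

    finite-U : ∃[ u ] HasCardinality (U Ind n) u
    finite-U = 𝒢[]-finite (IsUnique Ind) (λ e ¬mate → ¬mate ∘ HasMate-invariant Ind (≅-sym e)) (¬? ∘ hasMate?) n

    finite-M : ∃[ l ] HasCardinality (𝒢[ HasMate Ind ] n) l
    finite-M = 𝒢[]-finite (HasMate Ind) (HasMate-invariant Ind) hasMate? n

  ∣U∣ ∣M∣ : ℕ
  ∣U∣ = proj₁ finite-U
  ∣M∣ = proj₁ finite-M

  ∣U∣-card : HasCardinality (U Ind n) ∣U∣
  ∣U∣-card = proj₂ finite-U

  ∣M∣-card : HasCardinality (𝒢[ HasMate Ind ] n) ∣M∣
  ∣M∣-card = proj₂ finite-M

  ∣U∣+∣M∣-card : HasCardinality (𝒢 n) (∣U∣ + ∣M∣)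
  ∣U∣+∣M∣-card = 𝒢-card-+ (HasMate Ind) (HasMate-invariant Ind) hasMate? ∣U∣-card ∣M∣-card

-- Already `n * ∣U∣ n` is below the number of classes, so a fixed factor `d` is absorbed once
-- `n ≥ d`.
∣U∣-negligible : ∀ d n → n ≥ 576 ⊔ d → d * ∣U∣ n < ∣U∣ n + ∣M∣ n
∣U∣-negligible d n n≥ = ℕ.≤-<-trans
  (ℕ.*-monoˡ-≤ (∣U∣ n) (ℕ.≤-trans (ℕ.m≤n⊔m 576 d) n≥))
  (∣U∣-bound n (ℕ.≤-trans (ℕ.m≤m⊔n 576 d) n≥) (∣U∣+∣M∣-card n) (∣U∣-card n))

Ind-weaklyDistinguishing : WeaklyDistinguishing Ind
Ind-weaklyDistinguishing = record
  { ∣S∣ = ∣U∣ ; ∣𝒢∣ = λ n → ∣U∣ n + ∣M∣ n ; ∣S∣-card = ∣U∣-card ; ∣𝒢∣-card = ∣U∣+∣M∣-card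
  ; limit = λ ε 0<ε → 576 ⊔ ↧ₙ ε , λ n n≥ →
      ∣k/g-0∣<ε (∣U∣ n) (∣U∣ n + ∣M∣ n) {{𝒢-nonZero (∣U∣+∣M∣-card n)}} ε 0<ε (∣U∣-negligible (↧ₙ ε) n n≥)
  }

Ind-almostAll : AlmostAll (HasMate Ind)
Ind-almostAll = record
  { ∣S∣ = ∣M∣ ; ∣𝒢∣ = λ n → ∣U∣ n + ∣M∣ n ; ∣S∣-card = ∣M∣-card ; ∣𝒢∣-card = ∣U∣+∣M∣-card
  ; limit = λ ε 0<ε → 576 ⊔ ↧ₙ ε , λ n n≥ →
      ∣l/[k+l]-1∣<ε (∣U∣ n) (∣M∣ n) {{𝒢-nonZero (∣U∣+∣M∣-card n)}} ε 0<ε (∣U∣-negligible (↧ₙ ε) n n≥)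
  }

Ind⇒Cl : (G : Graph (Fin n)) → HasMate Ind G → HasMate Cl (co G)
Ind⇒Cl = HasMate-co Ind Cl Cl-co

Cl⇒Ind : (G : Graph (Fin n)) → HasMate Cl G → HasMate Ind (co G)
Cl⇒Ind = HasMate-co Cl Ind Ind-co

theorem2 : (WeaklyDistinguishing Ind × WeaklyDistinguishing Cl) × (AlmostAll (HasMate Ind) × AlmostAll (HasMate Cl))
theorem2 =
  ( Ind-weaklyDistinguishing
  , HasDensity-co {IsUnique Ind} {IsUnique Cl}
      -- A `Cl`-mate of `co G` would give an `Ind`-mate of `co (co G)`, hence one of `G`.
      (λ G ¬mate → ¬mate ∘ HasMate-invariant Ind (co-co-≅ G) ∘ Cl⇒Ind (co G))
      (λ G ¬mate → ¬mate ∘ HasMate-invariant Cl (co-co-≅ G) ∘ Ind⇒Cl (co G))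
      Ind-weaklyDistinguishing )
  , Ind-almostAll
  , HasDensity-co {HasMate Ind} {HasMate Cl} Ind⇒Cl Cl⇒Ind Ind-almostAll
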